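{- Let $G$ be a graph with minimum degree $\delta$ and maximum cut $\beta$. Then \[\alpha_{ir}(G) \leq \frac{ -2 \delta +1 + \sqrt{(2 \delta -1)^2 +8\beta}}{2}.\] Moreover, the bound is sharp: there exist graphs for which equality holds.
   Context: All graphs are finite, simple, undirected and have at least one vertex. An irregular independent set of a graph $G$ is an independent set $A$ of $G$ such that any two distinct vertices in $A$ have different degrees in $G$. The irregular independence number $\alpha_{ir}(G)$ is the size of a largest irregular independent set of $G$. For $A \subseteq V(G)$, $e(A, V(G)\setminus A)$ is the number of edges of $G$ with one vertex in $A$ and the other in $V(G) \setminus A$. The maximum cut of $G$ is $\beta = \beta(G) = \max\{e(A, V(G)\setminus A) : A \subseteq V(G)\}$. -}

module Defs where

open import Data.Fin.Base using (Fin; zero)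
open import Data.Fin.Properties as Fin using (all?)
open import Data.Fin.Subset using (Subset; inside; outside; ∣_∣; ∁; _∈_)
open import Data.Fin.Subset.Properties using (_∈?_)
open import Data.Integer.Base as ℤ using (+_)
open import Data.List.Base using (List; []; _∷_; _++_; map; filter; length; allFin; cartesianProduct)
open import Data.List.Extrema.Nat using (max; min)
open import Data.Nat.Base as ℕ using (ℕ; zero; suc)
open import Data.Nat.Properties as ℕₚ using ()
open import Data.Product.Base using (∃-syntax; _×_; _,_)
open import Data.Rational.Base renaming (∣_∣ to abs)
open import Data.Rational.Properties
open import Data.Rational.Solver using (module +-*-Solver)
open import Data.Sum.Base using (_⊎_; inj₁; inj₂)
open import Data.Vec.Base using ([]; _∷_; tabulate)
open import Level using (0ℓ)
open import Relation.Binary.Core using (Rel)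
open import Relation.Binary.Definitions using (Decidable; Symmetric; Irreflexive)
open import Relation.Binary.PropositionalEquality
open import Relation.Nullary

record Graph (n : ℕ) : Set₁ where
  field
    Adj     : Rel (Fin n) 0ℓ
    adj?    : Decidable Adj
    symm    : Symmetric Adj
    irrefl  : Irreflexive _≡_ Adj

allSubsets : ∀ n → List (Subset n)
allSubsets zero    = [] ∷ []
allSubsets (suc n) = map (outside ∷_) (allSubsets n) ++ map (inside ∷_) (allSubsets n)

module _ {n : ℕ} (G : Graph n) where
  open Graph G

  neighbours : Fin n → Subset n
  neighbours v = tabulate (λ u → does (adj? v u))

  degree : Fin n → ℕ
  degree v = ∣ neighbours v ∣

  Independent : Subset n → Set
  Independent A = ∀ u v → u ∈ A → v ∈ A → ¬ Adj u v

  Irregular : Subset n → Set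
  Irregular A = ∀ u v → u ∈ A → v ∈ A → u ≢ v → degree u ≢ degree v

  IrregularIndependent : Subset n → Set
  IrregularIndependent A = Independent A × Irregular A

  irregularIndependent? : ∀ A → Dec (IrregularIndependent A)
  irregularIndependent? A =
    all? (λ u → all? λ v → u ∈? A →-dec v ∈? A →-dec ¬? (adj? u v))
    ×-dec
    all? (λ u → all? λ v → u ∈? A →-dec v ∈? A →-dec
      ¬? (u Fin.≟ v) →-dec ¬? (degree u ℕₚ.≟ degree v))

  -- The empty set is irregular and independent, so the default 0 is harmless.
  αᵢᵣ : ℕ
  αᵢᵣ = max 0 (map ∣_∣ (filter irregularIndependent? (allSubsets n)))

  -- An edge joining A to its complement is counted exactly once, as the
  -- ordered pair whose first component is its end in A.
  cutSize : Subset n → ℕ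
  cutSize A = length (filter
    (λ (u , v) → u ∈? A ×-dec v ∈? ∁ A ×-dec adj? u v)
    (cartesianProduct (allFin n) (allFin n)))

  maxCut : ℕ
  maxCut = max 0 (map cutSize (allSubsets n))

minDegree : ∀ {n} → Graph (suc n) → ℕ
minDegree {n} G = min (degree G zero) (map (degree G) (allFin (suc n)))

-- Two-sided Dedekind reals: L holds of the rationals strictly below the real,
-- U of those strictly above it.
record ℝ : Set₁ where
  field
    L U         : ℚ → Set
    L-inhabited : ∃[ q ] L q
    U-inhabited : ∃[ q ] U q
    L-lower     : ∀ {p q} → p < q → L q → L p
    U-upper     : ∀ {p q} → p < q → U p → U q
    L-open      : ∀ {p} → L p → ∃[ q ] p < q × L q
    U-open      : ∀ {q} → U q → ∃[ p ] p < q × U p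
    disjoint    : ∀ {q} → L q → ¬ U q
    located     : ∀ {p q} → p < q → L p ⊎ U q

-- By locatedness and openness the lower cut determines the upper one, so
-- comparing lower cuts suffices.
infix 4 _≤ᴿ_ _≃ᴿ_

_≤ᴿ_ : ℝ → ℝ → Set
x ≤ᴿ y = ∀ q → ℝ.L x q → ℝ.L y q

_≃ᴿ_ : ℝ → ℝ → Set
x ≃ᴿ y = x ≤ᴿ y × y ≤ᴿ x

private
  open +-*-Solver

  p<p+1 : ∀ p → p < p + 1ℚ
  p<p+1 p = subst (_< p + 1ℚ) (+-identityʳ p) (+-monoʳ-< p (positive⁻¹ 1ℚ))

  p-1<p : ∀ p → p - 1ℚ < p
  p-1<p p = subst (p - 1ℚ <_) (+-identityʳ p) (+-monoʳ-< p (negative⁻¹ (- 1ℚ)))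

  p-r+r : ∀ p r → p - r + r ≡ p
  p-r+r = solve 2 (λ p r → p :- r :+ r := p) refl

  p+r-r : ∀ p r → p + r - r ≡ p
  p+r-r = solve 2 (λ p r → p :+ r :- r := p) refl

  0<q-p : ∀ {p q} → p < q → 0ℚ < q - p
  0<q-p {p} {q} p<q = subst (_< q - p) (+-inverseʳ p) (+-monoˡ-< (- p) p<q)

fromℚ : ℚ → ℝ
fromℚ a = record
  { L           = _< a
  ; U           = a <_
  ; L-inhabited = a - 1ℚ , p-1<p a
  ; U-inhabited = a + 1ℚ , p<p+1 a
  ; L-lower     = <-trans
  ; U-upper     = λ p<q a<p → <-trans a<p p<q
  ; L-open      = λ p<a → let r , p<r , r<a = <-dense p<a in r , p<r , r<a
  ; U-open      = λ a<q → let r , a<r , r<q = <-dense a<q in r , r<q , a<r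
  ; disjoint    = <-asym
  ; located     = loc
  }
  where
  loc : ∀ {p q} → p < q → p < a ⊎ a < q
  loc {p} p<q with p <? a
  ... | yes p<a = inj₁ p<a
  ... | no  p≮a = inj₂ (≤-<-trans (≮⇒≥ p≮a) p<q)

infixr 6 _ℚ+ᴿ_
infixl 7 _÷ᴿ_

_ℚ+ᴿ_ : ℚ → ℝ → ℝ
a ℚ+ᴿ x = record
  { L           = λ q → L (q - a)
  ; U           = λ q → U (q - a)
  ; L-inhabited = let q , Lq = L-inhabited in q + a , subst L (sym (p+r-r q a)) Lq
  ; U-inhabited = let q , Uq = U-inhabited in q + a , subst U (sym (p+r-r q a)) Uq
  ; L-lower     = λ p<q → L-lower (+-monoˡ-< (- a) p<q)
  ; U-upper     = λ p<q → U-upper (+-monoˡ-< (- a) p<q)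
  ; L-open      = λ {p} Lp → let q , p<q , Lq = L-open Lp in
      q + a , subst (_< q + a) (p-r+r p a) (+-monoˡ-< a p<q) , subst L (sym (p+r-r q a)) Lq
  ; U-open      = λ {q} Uq → let p , p<q , Up = U-open Uq in
      p + a , subst (p + a <_) (p-r+r q a) (+-monoˡ-< a p<q) , subst U (sym (p+r-r p a)) Up
  ; disjoint    = disjoint
  ; located     = λ p<q → located (+-monoˡ-< (- a) p<q)
  }
  where open ℝ x

_÷ᴿ_ : ℝ → (c : ℚ) .{{_ : Positive c}} → ℝ
x ÷ᴿ c = record
  { L           = λ q → L (q * c)
  ; U           = λ q → U (q * c)
  ; L-inhabited = let q , Lq = L-inhabited in q * c⁻¹ , subst L (sym (q/c*c q)) Lq
  ; U-inhabited = let q , Uq = U-inhabited in q * c⁻¹ , subst U (sym (q/c*c q)) Uq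
  ; L-lower     = λ p<q → L-lower (*-monoˡ-<-pos c p<q)
  ; U-upper     = λ p<q → U-upper (*-monoˡ-<-pos c p<q)
  ; L-open      = λ {p} Lp → let q , p<q , Lq = L-open Lp in
      q * c⁻¹ , cancel (subst (p * c <_) (sym (q/c*c q)) p<q) , subst L (sym (q/c*c q)) Lq
  ; U-open      = λ {q} Uq → let p , p<q , Up = U-open Uq in
      p * c⁻¹ , cancel (subst (_< q * c) (sym (q/c*c p)) p<q) , subst U (sym (q/c*c p)) Up
  ; disjoint    = disjoint
  ; located     = λ p<q → located (*-monoˡ-<-pos c p<q)
  }
  where
  open ℝ x
  instance
    c≢0 : NonZero c
    c≢0 = pos⇒nonZero c
  c⁻¹ : ℚ
  c⁻¹ = 1/ c
  q/c*c : ∀ q → q * c⁻¹ * c ≡ q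
  q/c*c q = trans (*-assoc q c⁻¹ c) (trans (cong (q *_) (*-inverseˡ c)) (*-identityʳ q))
  cancel : ∀ {p q} → p * c < q * c → p < q
  cancel = *-cancelʳ-<-nonNeg c {{pos⇒nonNeg c}}

private
  0≤-* : ∀ {p q} → 0ℚ ≤ p → 0ℚ ≤ q → 0ℚ ≤ p * q
  0≤-* {p} {q} 0≤p 0≤q = subst (_≤ p * q) (*-zeroˡ q) (*-monoʳ-≤-nonNeg q {{nonNegative 0≤q}} 0≤p)

  0<-* : ∀ {p q} → 0ℚ < p → 0ℚ < q → 0ℚ < p * q
  0<-* {p} {q} 0<p 0<q = subst (_< p * q) (*-zeroˡ q) (*-monoˡ-<-pos q {{positive 0<q}} 0<p)

  *-mono-≤-0≤ : ∀ {p q r s} → 0ℚ ≤ p → 0ℚ ≤ s → p ≤ q → r ≤ s → p * r ≤ q * s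
  *-mono-≤-0≤ {p} {q} {r} {s} 0≤p 0≤s p≤q r≤s = ≤-trans
    (*-monoˡ-≤-nonNeg p {{nonNegative 0≤p}} r≤s)
    (*-monoʳ-≤-nonNeg s {{nonNegative 0≤s}} p≤q)

  square-mono-< : ∀ {p q} → 0ℚ ≤ p → p < q → p * p < q * q
  square-mono-< {p} {q} 0≤p p<q = ≤-<-trans
    (*-monoˡ-≤-nonNeg p {{nonNegative 0≤p}} (<⇒≤ p<q))
    (*-monoˡ-<-pos q {{positive (≤-<-trans 0≤p p<q)}} p<q)

  quotient : ∀ p {d} → 0ℚ < d → ∃[ e ] e * d ≡ p
  quotient p {d} 0<d = p * 1/ d ,
    trans (*-assoc p (1/ d) d) (trans (cong (p *_) (*-inverseˡ d)) (*-identityʳ p))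
    where instance
      d≢0 : NonZero d
      d≢0 = pos⇒nonZero d {{positive 0<d}}

  cancel-< : ∀ {d} → 0ℚ < d → ∀ {p q} → p * d < q * d → p < q
  cancel-< {d} 0<d = *-cancelʳ-<-nonNeg d {{nonNegative (<⇒≤ 0<d)}}

  0<quotient : ∀ {e d} → 0ℚ < d → 0ℚ < e * d → 0ℚ < e
  0<quotient {e} {d} 0<d 0<ed = cancel-< 0<d (subst (_< e * d) (sym (*-zeroˡ d)) 0<ed)

  -- r = q + (a - q²) / (2q + a + 1)
  below-sqrt-open : ∀ {a q} → 0ℚ ≤ q → q * q < a → ∃[ r ] q < r × r * r < a
  below-sqrt-open {a} {q} 0≤q qq<a with quotient (a - q * q) 0<d
    where
    0<d : 0ℚ < q + q + a + 1ℚ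
    0<d = +-mono-≤-< (+-mono-≤ (+-mono-≤ 0≤q 0≤q) (≤-trans (0≤-* 0≤q 0≤q) (<⇒≤ qq<a))) (positive⁻¹ 1ℚ)
  ... | e , ed≡ = q + e , q<q+e , rr<a
    where
    d : ℚ
    d = q + q + a + 1ℚ
    0≤a : 0ℚ ≤ a
    0≤a = ≤-trans (0≤-* 0≤q 0≤q) (<⇒≤ qq<a)
    1≤d : 1ℚ ≤ d
    1≤d = +-mono-≤ {0ℚ} {q + q + a} {1ℚ} {1ℚ} (+-mono-≤ (+-mono-≤ 0≤q 0≤q) 0≤a) ≤-refl
    0<d : 0ℚ < d
    0<d = <-≤-trans (positive⁻¹ 1ℚ) 1≤d
    0<e : 0ℚ < e
    0<e = 0<quotient 0<d (subst (0ℚ <_) (sym ed≡) (0<q-p qq<a))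
    q<q+e : q < q + e
    q<q+e = subst (_< q + e) (+-identityʳ q) (+-monoʳ-< q 0<e)
    e<a+1 : e < a + 1ℚ
    e<a+1 = cancel-< 0<d (subst (_< (a + 1ℚ) * d) (sym ed≡) (≤-<-trans a-qq≤a (<-≤-trans (p<p+1 a) a+1≤)))
      where
      a-qq≤a : a - q * q ≤ a
      a-qq≤a = subst (a - q * q ≤_) (+-identityʳ a) (+-monoʳ-≤ a (neg-antimono-≤ (0≤-* 0≤q 0≤q)))
      a+1≤ : a + 1ℚ ≤ (a + 1ℚ) * d
      a+1≤ = subst (_≤ (a + 1ℚ) * d) (*-identityʳ (a + 1ℚ))
        (*-monoˡ-≤-nonNeg (a + 1ℚ) {{nonNegative (≤-trans 0≤a (<⇒≤ (p<p+1 a)))}} 1≤d)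
    rr<a : (q + e) * (q + e) < a
    rr<a = subst₂ _<_ lhs rhs
      (+-monoʳ-< (q * q) (*-monoʳ-<-pos e {{positive 0<e}} (+-monoʳ-< (q + q) e<a+1)))
      where
      lhs : q * q + e * (q + q + e) ≡ (q + e) * (q + e)
      lhs = solve 2 (λ q e → q :* q :+ e :* (q :+ q :+ e) := (q :+ e) :* (q :+ e)) refl q e
      rhs : q * q + e * (q + q + (a + 1ℚ)) ≡ a
      rhs = trans
        (solve 4 (λ q e a o → q :* q :+ e :* (q :+ q :+ (a :+ o)) := e :* (q :+ q :+ a :+ o) :+ q :* q) refl q e a 1ℚ)
        (trans (cong (_+ q * q) ed≡) (p-r+r a (q * q)))

  -- r = q - (q² - a) / 2q
  above-sqrt-open : ∀ {a q} → 0ℚ ≤ a → 0ℚ < q → a < q * q → ∃[ r ] r < q × 0ℚ < r × a < r * r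
  above-sqrt-open {a} {q} 0≤a 0<q a<qq with quotient (q * q - a) (+-mono-< 0<q 0<q)
  ... | e , ed≡ = q - e , r<q , 0<r , a<rr
    where
    0<d : 0ℚ < q + q
    0<d = +-mono-< 0<q 0<q
    0<e : 0ℚ < e
    0<e = 0<quotient 0<d (subst (0ℚ <_) (sym ed≡) (0<q-p a<qq))
    r<q : q - e < q
    r<q = subst (q - e <_) (+-identityʳ q) (+-monoʳ-< q (neg-antimono-< 0<e))
    0<r : 0ℚ < q - e
    0<r = 0<quotient 0<d (subst (0ℚ <_) (sym eq) (+-mono-<-≤ (0<-* 0<q 0<q) 0≤a))
      where
      eq : (q - e) * (q + q) ≡ q * q + a
      eq = trans
        (solve 2 (λ q e → (q :- e) :* (q :+ q) := q :* q :+ q :* q :- e :* (q :+ q)) refl q e)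
        (trans (cong (λ z → q * q + q * q - z) ed≡)
          (solve 2 (λ s a → s :+ s :- (s :- a) := s :+ a) refl (q * q) a))
    a<rr : a < (q - e) * (q - e)
    a<rr = subst₂ _<_ (+-identityʳ a) (sym eq) (+-monoʳ-< a (0<-* 0<e 0<e))
      where
      eq : (q - e) * (q - e) ≡ a + e * e
      eq = trans
        (solve 2 (λ q e → (q :- e) :* (q :- e) := q :* q :- e :* (q :+ q) :+ e :* e) refl q e)
        (trans (cong (λ z → q * q - z + e * e) ed≡)
          (solve 3 (λ s a t → s :- (s :- a) :+ t := a :+ t) refl (q * q) a (e * e)))

-- The nonnegative square root of a; it is 0 if a is negative.
√ : ℚ → ℝ
√ a = record
  { L           = L
  ; U           = U
  ; L-inhabited = - 1ℚ , inj₁ (negative⁻¹ (- 1ℚ))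
  ; U-inhabited = u , <-≤-trans (positive⁻¹ 1ℚ) 1≤u , <-≤-trans a<u u≤uu
  ; L-lower     = lower
  ; U-upper     = λ p<q (0<p , a<pp) →
      <-trans 0<p p<q , <-trans a<pp (square-mono-< (<⇒≤ 0<p) p<q)
  ; L-open      = L-open
  ; U-open      = U-open
  ; disjoint    = λ { (inj₁ q<0) (0<q , _) → <-asym q<0 0<q
                    ; (inj₂ qq<a) (_ , a<qq) → <-asym qq<a a<qq }
  ; located     = located
  }
  where
  L U : ℚ → Set
  L q = q < 0ℚ ⊎ q * q < a
  U q = 0ℚ < q × a < q * q

  u : ℚ
  u = abs a + 1ℚ
  1≤u : 1ℚ ≤ u
  1≤u = +-monoˡ-≤ 1ℚ (0≤∣p∣ a)
  a≤∣a∣ : a ≤ abs a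
  a≤∣a∣ with 0ℚ ≤? a
  ... | yes 0≤a = ≤-reflexive (sym (0≤p⇒∣p∣≡p 0≤a))
  ... | no  0≰a = ≤-trans (<⇒≤ (≰⇒> 0≰a)) (0≤∣p∣ a)
  a<u : a < u
  a<u = ≤-<-trans a≤∣a∣ (p<p+1 (abs a))
  u≤uu : u ≤ u * u
  u≤uu = subst (_≤ u * u) (*-identityʳ u)
    (*-monoˡ-≤-nonNeg u {{nonNegative (≤-trans (<⇒≤ (positive⁻¹ 1ℚ)) 1≤u)}} 1≤u)

  lower : ∀ {p q} → p < q → L q → L p
  lower {p} p<q (inj₁ q<0) = inj₁ (<-trans p<q q<0)
  lower {p} p<q (inj₂ qq<a) with p <? 0ℚ
  ... | yes p<0 = inj₁ p<0
  ... | no  p≮0 = inj₂ (<-trans (square-mono-< (≮⇒≥ p≮0) p<q) qq<a)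

  L-open : ∀ {p} → L p → ∃[ q ] p < q × L q
  L-open {p} (inj₁ p<0) = let q , p<q , q<0 = <-dense p<0 in q , p<q , inj₁ q<0
  L-open {p} (inj₂ pp<a) with p <? 0ℚ
  ... | yes p<0 = let q , p<q , q<0 = <-dense p<0 in q , p<q , inj₁ q<0
  ... | no  p≮0 = let q , p<q , qq<a = below-sqrt-open (≮⇒≥ p≮0) pp<a in q , p<q , inj₂ qq<a

  U-open : ∀ {q} → U q → ∃[ p ] p < q × U p
  U-open {q} (0<q , a<qq) with 0ℚ ≤? a
  ... | yes 0≤a = above-sqrt-open 0≤a 0<q a<qq
  ... | no  0≰a = let p , 0<p , p<q = <-dense 0<q in
    p , p<q , 0<p , <-trans (≰⇒> 0≰a) (0<-* 0<p 0<p)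

  located : ∀ {p q} → p < q → L p ⊎ U q
  located {p} {q} p<q with p <? 0ℚ | p * p <? a
  ... | yes p<0 | _        = inj₁ (inj₁ p<0)
  ... | no  _   | yes pp<a = inj₁ (inj₂ pp<a)
  ... | no  p≮0 | no  pp≮a = inj₂
    (≤-<-trans (≮⇒≥ p≮0) p<q , ≤-<-trans (≮⇒≥ pp≮a) (square-mono-< (≮⇒≥ p≮0) p<q))

fromℕ : ℕ → ℝ
fromℕ k = fromℚ (+ k / 1)

irregularBound : (δ β : ℕ) → ℝ
irregularBound δ β =
  ((ℤ.- (+ 2 ℤ.* + δ) ℤ.+ + 1) / 1 ℚ+ᴿ √ (((+ 2 ℤ.* + δ ℤ.- + 1) ℤ.^ 2 ℤ.+ + 8 ℤ.* + β) / 1))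
  ÷ᴿ (+ 2 / 1)

{-# OPTIONS --safe #-}

-- An independent set A sends all of its edges to its complement, so the degrees
-- of its k = |A| vertices add up to the size of the cut defined by A. If A is
-- also irregular these degrees are distinct and at least δ, hence
-- k δ + k (k − 1) / 2 ≤ β, that is, (2k + 2δ − 1)² ≤ (2δ − 1)² + 8β. The bound
-- is attained by the graph with a single vertex.
module Submission where

open import Defs
open import Data.Bool.Base using (true; false)
open import Data.Empty using (⊥)
open import Data.Fin.Base using (Fin; zero; suc)
open import Data.Fin.Subset using (Subset; inside; outside; ∣_∣; ∁; _∈_)
open import Data.Fin.Subset.Properties using (_∈?_; x∉p⇒x∈∁p)
open import Data.Integer.Base as ℤ using (ℤ; +_; +≤+)
import Data.Integer.Properties as ℤₚ
import Data.Integer.Tactic.RingSolver as ℤ-Solver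
open import Data.List.Base using (List; []; _∷_; length; filter; map; tabulate; allFin; cartesianProduct)
open import Data.List.Extrema.Nat using (argmax-all; min≤xs; xs≤max)
import Data.List.Membership.Propositional as List
open import Data.List.Membership.Propositional.Properties using (∈-allFin; ∈-map⁺; ∈-++⁺ˡ; ∈-++⁺ʳ)
open import Data.List.Properties using (filter-++; filter-accept; filter-reject; length-++; length-map; map-tabulate)
open import Data.List.Relation.Binary.Permutation.Propositional using (↭-sym; ↭⇒↭ₛ)
open import Data.List.Relation.Binary.Permutation.Propositional.Properties using (All-resp-↭; ↭-length)
import Data.List.Relation.Binary.Permutation.Setoid.Properties as Permutation
open import Data.List.Relation.Unary.All as All using (All; []; _∷_)
open import Data.List.Relation.Unary.All.Properties as All using (all-filter)
open import Data.List.Relation.Unary.AllPairs as AllPairs using (AllPairs; []; _∷_)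
import Data.List.Relation.Unary.AllPairs.Properties as AllPairs
open import Data.List.Relation.Unary.Any using (here)
open import Data.List.Relation.Unary.Sorted.TotalOrder.Properties using (Sorted⇒AllPairs)
open import Data.List.Relation.Unary.Unique.Propositional using (Unique)
open import Data.List.Relation.Unary.Unique.Propositional.Properties using (allFin⁺; filter⁺)
open import Data.Nat.Base using (ℕ; suc; _+_; _*_; _≤_; _<_; z≤n)
open import Data.Nat.ListAction using (sum)
open import Data.Nat.ListAction.Properties using (sum-↭)
import Data.Nat.Properties as ℕ
import Data.Nat.Tactic.RingSolver as ℕ-Solver
open import Data.Product.Base using (_×_; _,_; proj₂; ∃-syntax)
open import Data.Rational.Base as ℚ using (ℚ; 0ℚ; 1ℚ; _/_; toℚᵘ)
import Data.Rational.Properties as ℚ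
open import Data.Rational.Unnormalised.Base as ℚᵘ using (mkℚᵘ; *≡*; *≤*)
import Data.Rational.Unnormalised.Properties as ℚᵘ
open import Data.Sum.Base using (inj₁; inj₂)
open import Data.Vec.Base using ([]; _∷_; lookup)
open import Data.Vec.Properties using (lookup∘tabulate)
open import Function.Base using (_∘_; id)
open import Level using (Level)
open import Relation.Binary.Core using (Rel)
open import Relation.Binary.PropositionalEquality
open import Relation.Nullary using (Dec; does; yes; no; contradiction)
open import Relation.Nullary.Decidable using (dec-true; dec-false; _×-dec_)
open import Relation.Unary using (Pred; Decidable)
open import Data.List.Sort ℕ.≤-decTotalOrder using (sort; sort-↭; sort-↗)

private
  variable
    a p r : Level
    A : Set a
    n : ℕ

-- Sums of distinct natural numbers

-- sum xs ≥ k d + k (k − 1) / 2 for k = length xs, doubled and free of subtraction.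
SumBound : ℕ → List ℕ → Set
SumBound d xs = length xs * length xs + 2 * (length xs * d) ≤ 2 * sum xs + length xs

-- Induction with `d` varying: the entries after the head exceed it, so `suc d` is a lower bound for
-- the tail. The i-th smallest entry is thus at least d + i, counting from 0.
increasing⇒sumBound : ∀ d {xs} → AllPairs _<_ xs → All (d ≤_) xs → SumBound d xs
increasing⇒sumBound d [] [] = z≤n
increasing⇒sumBound d {x ∷ xs} (x<xs ∷ xs<) (d≤x ∷ _) = begin
  suc k * suc k + 2 * (suc k * d)            ≡⟨ expand k d ⟩
  (2 * d + 1) + (k * k + 2 * (k * suc d))    ≤⟨ ℕ.+-mono-≤ (ℕ.+-monoˡ-≤ 1 (ℕ.*-monoʳ-≤ 2 d≤x))
                                                  (increasing⇒sumBound (suc d) xs< (All.map (ℕ.≤-<-trans d≤x) x<xs)) ⟩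
  (2 * x + 1) + (2 * sum xs + k)             ≡⟨ collect x (sum xs) k ⟩
  2 * (x + sum xs) + suc k                   ∎
  where
  open ℕ.≤-Reasoning
  k = length xs
  expand : ∀ k d → suc k * suc k + 2 * (suc k * d) ≡ (2 * d + 1) + (k * k + 2 * (k * suc d))
  expand = ℕ-Solver.solve-∀
  collect : ∀ x s k → (2 * x + 1) + (2 * s + k) ≡ 2 * (x + s) + suc k
  collect = ℕ-Solver.solve-∀

-- Length, sum and lower bound survive sorting, and a sorted list without repetitions is strictly
-- increasing.
unique⇒sumBound : ∀ d {xs} → Unique xs → All (d ≤_) xs → SumBound d xs
unique⇒sumBound d {xs} xs! d≤xs =
  subst₂ (λ k s → k * k + 2 * (k * d) ≤ 2 * s + k) (↭-length (sort-↭ xs)) (sum-↭ (sort-↭ xs))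
    (increasing⇒sumBound d sorted< (All-resp-↭ (↭-sym (sort-↭ xs)) d≤xs))
  where
  sorted! : Unique (sort xs)
  sorted! = Permutation.Unique-resp-↭ (setoid ℕ) (↭⇒↭ₛ (↭-sym (sort-↭ xs))) xs!
  sorted< : AllPairs _<_ (sort xs)
  sorted< = AllPairs.zipWith (λ (x≤y , x≢y) → ℕ.≤∧≢⇒< x≤y x≢y)
    (Sorted⇒AllPairs ℕ.≤-totalOrder (sort-↗ xs) , sorted!)

-- Subsets of a finite set as lists

-- Links the two ways of counting, filtered lists and Boolean vectors. It serves both for the size
-- of a vertex set and for the degree of a vertex.
length-filter-tabulate : {P : Pred A p} (P? : Decidable P) (f : Fin n → A) (S : Subset n) →
  (∀ i → does (P? (f i)) ≡ lookup S i) → length (filter P? (tabulate f)) ≡ ∣ S ∣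
length-filter-tabulate P? f []      eq = refl
length-filter-tabulate P? f (b ∷ S) eq
  with does (P? (f zero)) | eq zero | length-filter-tabulate P? (f ∘ suc) S (eq ∘ suc)
... | true  | refl | ih = cong suc ih
... | false | refl | ih = ih

does-∈? : (i : Fin n) (S : Subset n) → does (i ∈? S) ≡ lookup S i
does-∈? zero    (true  ∷ S) = refl
does-∈? zero    (false ∷ S) = refl
does-∈? (suc i) (b ∷ S)     = does-∈? i S

elements : Subset n → List (Fin n)
elements S = filter (_∈? S) (allFin _)

length-elements : (S : Subset n) → length (elements S) ≡ ∣ S ∣
length-elements S = length-filter-tabulate (_∈? S) id S (λ i → does-∈? i S)

∈-allSubsets : (S : Subset n) → S List.∈ allSubsets n
∈-allSubsets []            = here refl
∈-allSubsets (outside ∷ S) = ∈-++⁺ˡ (∈-map⁺ (outside ∷_) (∈-allSubsets S))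
∈-allSubsets (inside  ∷ S) = ∈-++⁺ʳ _ (∈-map⁺ (inside ∷_) (∈-allSubsets S))

unique⇒allPairs : {P : Pred A p} {R : Rel A r} → (∀ {x y} → P x → P y → x ≢ y → R x y) →
  ∀ {xs} → All P xs → Unique xs → AllPairs R xs
unique⇒allPairs f []         []           = []
unique⇒allPairs f (px ∷ pxs) (x∉xs ∷ xs!) =
  All.zipWith (λ (py , x≢y) → f px py x≢y) (pxs , x∉xs) ∷ unique⇒allPairs f pxs xs!

-- Degrees and cuts of irregular independent sets

module _ {n : ℕ} (G : Graph (suc n)) where
  open Graph G

  minDegree≤degree : ∀ v → minDegree G ≤ degree G v
  minDegree≤degree v = All.lookup (min≤xs (degree G zero) _) (∈-map⁺ (degree G) (∈-allFin v))

  cutSize≤maxCut : ∀ S → cutSize G S ≤ maxCut G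
  cutSize≤maxCut S = All.lookup (xs≤max 0 _) (∈-map⁺ (cutSize G) (∈-allSubsets S))

  module _ (S : Subset (suc n)) (indep : Independent G S) where

    private
      CutEdge? : Decidable (λ ((u , v) : Fin (suc n) × Fin (suc n)) → u ∈ S × v ∈ ∁ S × Adj u v)
      CutEdge? (u , v) = u ∈? S ×-dec v ∈? ∁ S ×-dec adj? u v

    -- Independence forces every neighbour of `u` out of `S`, so no edge at `u` is lost from the
    -- cut.
    length-cutEdges : ∀ {u} → u ∈ S →
      length (filter CutEdge? (map (u ,_) (allFin (suc n)))) ≡ degree G u
    length-cutEdges {u} u∈S = begin
      length (filter CutEdge? (map (u ,_) (allFin (suc n))))  ≡⟨ cong (length ∘ filter CutEdge?) (map-tabulate id (u ,_)) ⟩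
      length (filter CutEdge? (tabulate (u ,_)))              ≡⟨ length-filter-tabulate CutEdge? (u ,_) (neighbours G u) does-CutEdge? ⟩
      degree G u                                              ∎
      where
      open ≡-Reasoning
      cutEdge : ∀ v → does (CutEdge? (u , v)) ≡ does (adj? u v)
      cutEdge v with adj? u v
      ... | yes uv = dec-true (u ∈? S ×-dec v ∈? ∁ S ×-dec yes uv)
                       (u∈S , x∉p⇒x∈∁p (λ v∈S → indep u v u∈S v∈S uv) , uv)
      ... | no ¬uv = dec-false (u ∈? S ×-dec v ∈? ∁ S ×-dec no ¬uv) (¬uv ∘ proj₂ ∘ proj₂)
      does-CutEdge? : ∀ v → does (CutEdge? (u , v)) ≡ lookup (neighbours G u) v
      does-CutEdge? v = trans (cutEdge v) (sym (lookup∘tabulate (does ∘ adj? u) v))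

    sum-degrees≤cutSize : sum (map (degree G) (elements S)) ≤ cutSize G S
    sum-degrees≤cutSize = go (allFin (suc n))
      where
      ends = allFin (suc n)
      -- Only the first factor of the product shrinks in the induction; `ends` stays the full vertex
      -- list, so that each row counts a whole degree.
      go : ∀ us → sum (map (degree G) (filter (_∈? S) us)) ≤ length (filter CutEdge? (cartesianProduct us ends))
      go []       = z≤n
      go (u ∷ us) = ℕ.≤-trans (step (u ∈? S)) (ℕ.≤-reflexive (sym split))
        where
        cut = length (filter CutEdge? (map (u ,_) ends))
        rest = length (filter CutEdge? (cartesianProduct us ends))
        split : length (filter CutEdge? (cartesianProduct (u ∷ us) ends)) ≡ cut + rest
        split = trans (cong length (filter-++ CutEdge? (map (u ,_) ends) _))
                      (length-++ (filter CutEdge? (map (u ,_) ends)))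
        step : Dec (u ∈ S) → sum (map (degree G) (filter (_∈? S) (u ∷ us))) ≤ cut + rest
        step (yes u∈S) rewrite filter-accept (_∈? S) {xs = us} u∈S =
          ℕ.+-mono-≤ (ℕ.≤-reflexive (sym (length-cutEdges u∈S))) (go us)
        -- A vertex outside `S` adds nothing to the degree sum, and its row can only enlarge the
        -- right side.
        step (no  u∉S) rewrite filter-reject (_∈? S) {xs = us} u∉S =
          ℕ.≤-trans (go us) (ℕ.m≤n+m rest cut)

  irregularIndependent⇒bound : ∀ S → IrregularIndependent G S →
    ∣ S ∣ * ∣ S ∣ + 2 * (∣ S ∣ * minDegree G) ≤ 2 * maxCut G + ∣ S ∣
  irregularIndependent⇒bound S (indep , irreg) = begin
    ∣ S ∣ * ∣ S ∣ + 2 * (∣ S ∣ * minDegree G)  ≤⟨ degrees-bound ⟩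
    2 * sum degrees + ∣ S ∣                   ≤⟨ ℕ.+-monoˡ-≤ ∣ S ∣ (ℕ.*-monoʳ-≤ 2
                                                  (ℕ.≤-trans (sum-degrees≤cutSize S indep) (cutSize≤maxCut S))) ⟩
    2 * maxCut G + ∣ S ∣                      ∎
    where
    open ℕ.≤-Reasoning
    degrees = map (degree G) (elements S)
    -- `elements S` lists each vertex once, and irregularity separates the degrees of distinct
    -- vertices.
    degrees! : Unique degrees
    degrees! = AllPairs.map⁺ (unique⇒allPairs (irreg _ _) (all-filter (_∈? S) (allFin (suc n)))
      (filter⁺ (_∈? S) (allFin⁺ (suc n))))
    degrees-bound : ∣ S ∣ * ∣ S ∣ + 2 * (∣ S ∣ * minDegree G) ≤ 2 * sum degrees + ∣ S ∣
    degrees-bound = subst (λ k → k * k + 2 * (k * minDegree G) ≤ 2 * sum degrees + k)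
      (trans (length-map (degree G) (elements S)) (length-elements S))
      (unique⇒sumBound (minDegree G) degrees! (All.map⁺ (All.universal minDegree≤degree (elements S))))

  -- A maximum is either the default or a listed value, so it inherits any property that all of
  -- these share. For the default 0 the left side vanishes, which is the `z≤n`.
  αᵢᵣ-bound : αᵢᵣ G * αᵢᵣ G + 2 * (αᵢᵣ G * minDegree G) ≤ 2 * maxCut G + αᵢᵣ G
  αᵢᵣ-bound = argmax-all id {P = λ k → k * k + 2 * (k * minDegree G) ≤ 2 * maxCut G + k} z≤n
    (All.map⁺ (All.map (irregularIndependent⇒bound _) (all-filter (irregularIndependent? G) (allSubsets (suc n)))))

-- The embedding of the integers into the rationals

module _ where
  open ℚᵘ.≃-Reasoning

  -- `i / 1` is put in lowest terms through a gcd, which is stuck for a variable `i`. The laws below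
  -- are therefore checked on unnormalised fractions.
  toℚᵘ-/1 : ∀ i → toℚᵘ (i / 1) ℚᵘ.≃ mkℚᵘ i 0
  toℚᵘ-/1 i = ℚ.toℚᵘ-fromℚᵘ (mkℚᵘ i 0)

  /1-homo-+ : ∀ i j → (i ℤ.+ j) / 1 ≡ i / 1 ℚ.+ j / 1
  /1-homo-+ i j = ℚ.toℚᵘ-injective (begin
    toℚᵘ ((i ℤ.+ j) / 1)              ≈⟨ toℚᵘ-/1 (i ℤ.+ j) ⟩
    mkℚᵘ (i ℤ.+ j) 0                  ≈⟨ *≡* (cong (ℤ._* + 1) (sym (cong₂ ℤ._+_ (ℤₚ.*-identityʳ i) (ℤₚ.*-identityʳ j)))) ⟩
    mkℚᵘ i 0 ℚᵘ.+ mkℚᵘ j 0            ≈⟨ ℚᵘ.+-cong (toℚᵘ-/1 i) (toℚᵘ-/1 j) ⟨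
    toℚᵘ (i / 1) ℚᵘ.+ toℚᵘ (j / 1)    ≈⟨ ℚ.toℚᵘ-homo-+ (i / 1) (j / 1) ⟨
    toℚᵘ (i / 1 ℚ.+ j / 1)            ∎)

  /1-homo-* : ∀ i j → (i ℤ.* j) / 1 ≡ (i / 1) ℚ.* (j / 1)
  /1-homo-* i j = ℚ.toℚᵘ-injective (begin
    toℚᵘ ((i ℤ.* j) / 1)              ≈⟨ toℚᵘ-/1 (i ℤ.* j) ⟩
    mkℚᵘ i 0 ℚᵘ.* mkℚᵘ j 0            ≈⟨ ℚᵘ.*-cong (toℚᵘ-/1 i) (toℚᵘ-/1 j) ⟨
    toℚᵘ (i / 1) ℚᵘ.* toℚᵘ (j / 1)    ≈⟨ ℚ.toℚᵘ-homo-* (i / 1) (j / 1) ⟨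
    toℚᵘ ((i / 1) ℚ.* (j / 1))        ∎)

  /1-homo‿- : ∀ i → (ℤ.- i) / 1 ≡ ℚ.- (i / 1)
  /1-homo‿- i = ℚ.toℚᵘ-injective (begin
    toℚᵘ ((ℤ.- i) / 1)      ≈⟨ toℚᵘ-/1 (ℤ.- i) ⟩
    ℚᵘ.- mkℚᵘ i 0           ≈⟨ ℚᵘ.-‿cong (toℚᵘ-/1 i) ⟨
    ℚᵘ.- toℚᵘ (i / 1)       ≈⟨ ℚ.toℚᵘ-homo‿- (i / 1) ⟨
    toℚᵘ (ℚ.- (i / 1))      ∎)

/1-mono-≤ : ∀ {i j} → i ℤ.≤ j → i / 1 ℚ.≤ j / 1
/1-mono-≤ {i} {j} i≤j = ℚ.toℚᵘ-cancel-≤ (begin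
  toℚᵘ (i / 1)  ≃⟨ toℚᵘ-/1 i ⟩
  mkℚᵘ i 0      ≤⟨ *≤* (ℤₚ.*-monoʳ-≤-nonNeg (+ 1) i≤j) ⟩
  mkℚᵘ j 0      ≃⟨ toℚᵘ-/1 j ⟨
  toℚᵘ (j / 1)  ∎)
  where open ℚᵘ.≤-Reasoning

-- From the integer inequality to the real bound

square-mono-≤ : ∀ {p q} → 0ℚ ℚ.≤ p → p ℚ.≤ q → p ℚ.* p ℚ.≤ q ℚ.* q
square-mono-≤ {p} {q} 0≤p p≤q = ℚ.≤-trans
  (ℚ.*-monoˡ-≤-nonNeg p {{ℚ.nonNegative 0≤p}} p≤q)
  (ℚ.*-monoʳ-≤-nonNeg q {{ℚ.nonNegative (ℚ.≤-trans 0≤p p≤q)}} p≤q)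

square-mono-< : ∀ {p q} → 0ℚ ℚ.≤ p → p ℚ.< q → p ℚ.* p ℚ.< q ℚ.* q
square-mono-< {p} {q} 0≤p p<q = ℚ.≤-<-trans
  (ℚ.*-monoˡ-≤-nonNeg p {{ℚ.nonNegative 0≤p}} (ℚ.<⇒≤ p<q))
  (ℚ.*-monoˡ-<-pos q {{ℚ.positive (ℚ.≤-<-trans 0≤p p<q)}} p<q)

module _ (k δ β : ℕ) where

  private
    -- The bound is (c + √N) / 2. Here `t` is 2k + 2δ - 1, written as 2k - c because a rational q
    -- lies below the bound exactly when 2q - c lies below √N.
    c t N : ℤ
    c = ℤ.- (+ 2 ℤ.* + δ) ℤ.+ + 1
    t = + k ℤ.* + 2 ℤ.+ ℤ.- c
    N = (+ 2 ℤ.* + δ ℤ.- + 1) ℤ.^ 2 ℤ.+ + 8 ℤ.* + β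

  -- Multiply the hypothesis by 4 and add (2δ - 1)² - 4k to both sides.
  complete-square : k * k + 2 * (k * δ) ≤ 2 * β + k → t ℤ.* t ℤ.≤ N
  complete-square bound = subst₂ ℤ._≤_ (lhs (+ k) (+ δ)) (rhs (+ k) (+ δ) (+ β))
    (ℤₚ.+-monoˡ-≤ ((+ 2 ℤ.* + δ ℤ.- + 1) ℤ.* (+ 2 ℤ.* + δ ℤ.- + 1) ℤ.- + 4 ℤ.* + k)
      (ℤₚ.*-monoˡ-≤-nonNeg (+ 4) boundℤ))
    where
    boundℤ : + k ℤ.* + k ℤ.+ + 2 ℤ.* (+ k ℤ.* + δ) ℤ.≤ + 2 ℤ.* + β ℤ.+ + k
    boundℤ = subst₂ ℤ._≤_
      (trans (ℤₚ.pos-+ (k * k) _) (cong₂ ℤ._+_ (ℤₚ.pos-* k k)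
        (trans (ℤₚ.pos-* 2 (k * δ)) (cong (+ 2 ℤ.*_) (ℤₚ.pos-* k δ)))))
      (trans (ℤₚ.pos-+ (2 * β) k) (cong (ℤ._+ + k) (ℤₚ.pos-* 2 β)))
      (+≤+ bound)
    lhs : ∀ k d → + 4 ℤ.* (k ℤ.* k ℤ.+ + 2 ℤ.* (k ℤ.* d))
        ℤ.+ ((+ 2 ℤ.* d ℤ.- + 1) ℤ.* (+ 2 ℤ.* d ℤ.- + 1) ℤ.- + 4 ℤ.* k)
      ≡ (k ℤ.* + 2 ℤ.+ ℤ.- (ℤ.- (+ 2 ℤ.* d) ℤ.+ + 1)) ℤ.* (k ℤ.* + 2 ℤ.+ ℤ.- (ℤ.- (+ 2 ℤ.* d) ℤ.+ + 1))
    lhs = ℤ-Solver.solve-∀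
    rhs : ∀ k d b → + 4 ℤ.* (+ 2 ℤ.* b ℤ.+ k)
        ℤ.+ ((+ 2 ℤ.* d ℤ.- + 1) ℤ.* (+ 2 ℤ.* d ℤ.- + 1) ℤ.- + 4 ℤ.* k)
      -- The trailing factor `+ 1` is what `^ 2` unfolds to, so this side agrees with `N` by
      -- computation.
      ≡ (+ 2 ℤ.* d ℤ.- + 1) ℤ.* ((+ 2 ℤ.* d ℤ.- + 1) ℤ.* + 1) ℤ.+ + 8 ℤ.* b
    rhs = ℤ-Solver.solve-∀

  -- For q < k put s = 2q - c, so s < t. Either s is negative, hence below the root by definition of
  -- its lower cut, or s² < t² ≤ N.
  fromℕ≤irregularBound : k * k + 2 * (k * δ) ≤ 2 * β + k → fromℕ k ≤ᴿ irregularBound δ β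
  fromℕ≤irregularBound bound q q<k with q ℚ.* (+ 2 / 1) ℚ.- c / 1 ℚ.<? 0ℚ
  ... | yes s<0 = inj₁ s<0
  ... | no  s≮0 = inj₂ (ℚ.<-≤-trans (square-mono-< (ℚ.≮⇒≥ s≮0) s<t) tt≤N)
    where
    t≡ : + k / 1 ℚ.* (+ 2 / 1) ℚ.- c / 1 ≡ t / 1
    t≡ = sym (trans (/1-homo-+ (+ k ℤ.* + 2) (ℤ.- c)) (cong₂ ℚ._+_ (/1-homo-* (+ k) (+ 2)) (/1-homo‿- c)))
    s<t : q ℚ.* (+ 2 / 1) ℚ.- c / 1 ℚ.< t / 1
    s<t = subst (q ℚ.* (+ 2 / 1) ℚ.- c / 1 ℚ.<_) t≡
      (ℚ.+-monoˡ-< (ℚ.- (c / 1)) (ℚ.*-monoˡ-<-pos (+ 2 / 1) q<k))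
    tt≤N : (t / 1) ℚ.* (t / 1) ℚ.≤ N / 1
    tt≤N = subst (ℚ._≤ N / 1) (/1-homo-* t t) (/1-mono-≤ (complete-square bound))

αᵢᵣ≤irregularBound : ∀ {n} (G : Graph (suc n)) → fromℕ (αᵢᵣ G) ≤ᴿ irregularBound (minDegree G) (maxCut G)
αᵢᵣ≤irregularBound G = fromℕ≤irregularBound (αᵢᵣ G) (minDegree G) (maxCut G) (αᵢᵣ-bound G)

-- Sharpness

K₁ : Graph 1
K₁ = record { Adj = λ _ _ → ⊥ ; adj? = λ _ _ → no id ; symm = id ; irrefl = λ _ () }

-- The bound is (1 + √1) / 2. If q ≥ 1 then s = 2q - 1 ≥ 1, which excludes both s < 0 and s² < 1,
-- the two ways of lying below √1.
irregularBound-0-0≤1 : irregularBound 0 0 ≤ᴿ fromℕ 1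
irregularBound-0-0≤1 q Lq with q ℚ.<? + 1 / 1
... | yes q<1 = q<1
... | no  q≮1 = contradiction Lq λ
  { (inj₁ s<0)  → ℚ.<-irrefl refl (ℚ.≤-<-trans 1≤s (ℚ.<-≤-trans s<0 (ℚ.nonNegative⁻¹ 1ℚ)))
  ; (inj₂ ss<1) → ℚ.<-irrefl refl (ℚ.≤-<-trans (square-mono-≤ (ℚ.nonNegative⁻¹ 1ℚ) 1≤s) ss<1)
  }
  where
  1≤s : 1ℚ ℚ.≤ q ℚ.* (+ 2 / 1) ℚ.- 1ℚ
  1≤s = ℚ.+-monoˡ-≤ (ℚ.- 1ℚ) (ℚ.*-monoʳ-≤-nonNeg (+ 2 / 1) (ℚ.≮⇒≥ q≮1))

theorem2p2 : (∀ {n : ℕ} (G : Graph (suc n)) →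
    fromℕ (αᵢᵣ G) ≤ᴿ irregularBound (minDegree G) (maxCut G))
    ×
    (∃[ n ] ∃[ G ] fromℕ (αᵢᵣ {suc n} G) ≃ᴿ irregularBound (minDegree G) (maxCut G))
-- For `K₁` the independence number, minimum degree and maximum cut evaluate to 1, 0 and 0, so the
-- last component has the required type by computation.
theorem2p2 = αᵢᵣ≤irregularBound , 0 , K₁ , αᵢᵣ≤irregularBound K₁ , irregularBound-0-0≤1
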